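{- Let $n,p,q$ be positive integers with $n>1$, and let $Q=p+q$. Then \[ A_{p,q}(Q^n+1)=\begin{cases} Q^n+Q-2, & \text{if } p>1 \text{ and } q>1,\\ Q^n+Q-1, & \text{if } q>p=1 \text{ or } p>q=1,\\ Q^n+Q, & \text{if } p=q=1.\end{cases} \]
   Context: For positive integers $p,q$, let $\theta_{p,q}$ be the generalised Thue--Morse substitution on $\{0,1\}$, $\theta_{p,q}\colon 0\mapsto 0^p1^q,\ 1\mapsto 1^p0^q$ (extended to words by concatenation), and let $v=v_0v_1v_2\dots=\lim_{n\to\infty}\theta_{p,q}^n(0)\in\{0,1\}^{\mathbb{N}}$ be the generalised Thue--Morse word, indexed from $0$. For positive integers $d,L$, a monochromatic arithmetic progression of difference $d$ and length $L$ in $v$ means that there is $i\ge 0$ with $v_i=v_{i+d}=\dots=v_{i+(L-1)d}$. $A_{p,q}(d)$ denotes the maximum length $L$ of a monochromatic arithmetic progression of difference $d$ in $v$ (this maximum exists and is finite for every $d\geq 1$). -}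

module Defs where

open import Data.Fin.Base using (Fin; toℕ; fromℕ<)
open import Data.Fin.Patterns using (0F; 1F)
open import Data.Fin.Properties using (toℕ-fromℕ<)
open import Data.List.Base using (List; []; _∷_; [_]; _++_; length; lookup; replicate; concatMap)
open import Data.List.Properties using (length-++; length-replicate; concatMap-++; ++-assoc; ++-identityʳ)
open import Data.Nat.Base
open import Data.Nat.GeneralisedArithmetic using (fold)
open import Data.Nat.Properties
open import Data.Product.Base using (_×_; _,_; ∃)
open import Data.Sum.Base using (inj₁; inj₂)
open import Relation.Binary.PropositionalEquality
  using (_≡_; refl; sym; trans; cong; cong₂; subst)

Word : Set
Word = List (Fin 2)

θ : ℕ → ℕ → Fin 2 → Word
θ p q 0F = replicate p 0F ++ replicate q 1F
θ p q 1F = replicate p 1F ++ replicate q 0F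

θ* : ℕ → ℕ → Word → Word
θ* p q = concatMap (θ p q)

θⁿ0 : (p q n : ℕ) → Word
θⁿ0 p q n = fold [ 0F ] (θ* p q) n

private
  length-θ : ∀ p q a → length (θ p q a) ≡ p + q
  length-θ p q 0F = trans (length-++ (replicate p 0F))
    (cong₂ _+_ (length-replicate p) (length-replicate q))
  length-θ p q 1F = trans (length-++ (replicate p 1F))
    (cong₂ _+_ (length-replicate p) (length-replicate q))

  length-θ* : ∀ p q w → length (θ* p q w) ≡ length w * (p + q)
  length-θ* p q []      = refl
  length-θ* p q (a ∷ w) = trans (length-++ (θ p q a))
    (cong₂ _+_ (length-θ p q a) (length-θ* p q w))

length-θⁿ0 : ∀ p q n → length (θⁿ0 p q n) ≡ (p + q) ^ n
length-θⁿ0 p q zero    = refl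
length-θⁿ0 p q (suc n) = trans (length-θ* p q (θⁿ0 p q n))
  (trans (cong (_* (p + q)) (length-θⁿ0 p q n)) (*-comm ((p + q) ^ n) (p + q)))

n<length-θⁿ0 : ∀ p q .{{_ : NonZero p}} .{{_ : NonZero q}} n → n < length (θⁿ0 p q n)
n<length-θⁿ0 p q n = subst (n <_) (sym (length-θⁿ0 p q n)) (n<m^n n)
  where
  2≤p+q : 2 ≤ p + q
  2≤p+q = +-mono-≤ (>-nonZero⁻¹ p) (>-nonZero⁻¹ q)

  n<m^n : ∀ n → n < (p + q) ^ n
  n<m^n zero    = s≤s z≤n
  n<m^n (suc n) = begin-strict
    suc n                       <⟨ s≤s (n<m^n n) ⟩
    1 + (p + q) ^ n             ≤⟨ +-monoˡ-≤ ((p + q) ^ n) (≤-trans (s≤s z≤n) (n<m^n n)) ⟩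
    (p + q) ^ n + (p + q) ^ n   ≡⟨ cong ((p + q) ^ n +_) (sym (+-identityʳ ((p + q) ^ n))) ⟩
    2 * (p + q) ^ n             ≤⟨ *-monoˡ-≤ ((p + q) ^ n) 2≤p+q ⟩
    (p + q) * (p + q) ^ n       ∎
    where open ≤-Reasoning

-- The limit of θⁿ(0): its i-th letter is already determined by θⁱ(0), which has
-- more than i letters.  That every θⁿ(0) is a prefix is v-limit below.
v : ∀ p q .{{_ : NonZero p}} .{{_ : NonZero q}} → ℕ → Fin 2
v p q i = lookup (θⁿ0 p q i) (fromℕ< (n<length-θⁿ0 p q i))

private
  θ^-step : ∀ p q .{{_ : NonZero p}} n → ∃ λ u → θⁿ0 p q (suc n) ≡ θⁿ0 p q n ++ u
  θ^-step (suc p) q zero    = (replicate p 0F ++ replicate q 1F) ++ [] , refl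
  θ^-step p       q (suc n) with u , eq ← θ^-step p q n =
    θ* p q u , trans (cong (θ* p q) eq) (concatMap-++ (θ p q) (θⁿ0 p q n) u)

  θ^-prefix : ∀ p q .{{_ : NonZero p}} {m n} → m ≤′ n → ∃ λ u → θⁿ0 p q n ≡ θⁿ0 p q m ++ u
  θ^-prefix p q {m} (≤′-reflexive refl) = [] , sym (++-identityʳ (θⁿ0 p q m))
  θ^-prefix p q {m} (≤′-step {n} m≤n)
    with u , eq ← θ^-prefix p q m≤n | u′ , eq′ ← θ^-step p q n =
    u ++ u′ , trans eq′ (trans (cong (_++ u′) eq) (++-assoc (θⁿ0 p q m) u u′))

  lookup-prefix : ∀ (xs : Word) {ys u} → ys ≡ xs ++ u →
                  ∀ (i : Fin (length xs)) (j : Fin (length ys)) → toℕ i ≡ toℕ j →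
                  lookup xs i ≡ lookup ys j
  lookup-prefix (x ∷ xs) refl 0F          0F          eq = refl
  lookup-prefix (x ∷ xs) refl (Fin.suc i) (Fin.suc j) eq =
    lookup-prefix xs refl i j (suc-injective eq)

v-limit : ∀ p q .{{_ : NonZero p}} .{{_ : NonZero q}} n (j : Fin (length (θⁿ0 p q n))) →
          lookup (θⁿ0 p q n) j ≡ v p q (toℕ j)
v-limit p q n j with ≤-total n (toℕ j)
... | inj₁ n≤j with u , eq ← θ^-prefix p q (≤⇒≤′ n≤j) =
  lookup-prefix (θⁿ0 p q n) eq j _ (sym (toℕ-fromℕ< (n<length-θⁿ0 p q (toℕ j))))
... | inj₂ j≤n with u , eq ← θ^-prefix p q (≤⇒≤′ j≤n) =
  sym (lookup-prefix (θⁿ0 p q (toℕ j)) eq _ j (toℕ-fromℕ< (n<length-θⁿ0 p q (toℕ j))))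

HasMonochromaticAP : (ℕ → Fin 2) → (d L : ℕ) → Set
HasMonochromaticAP w d L = 1 ≤ L × ∃ λ i → ∀ k → k < L → w (i + k * d) ≡ w i

IsMaximum : (ℕ → Set) → ℕ → Set
IsMaximum P m = P m × (∀ l → P l → l ≤ m)

-- The graph of the function A: A p q d L says that A_{p,q}(d) exists and equals L.
A : ∀ p q .{{_ : NonZero p}} .{{_ : NonZero q}} → (d L : ℕ) → Set
A p q d L = IsMaximum (HasMonochromaticAP (v p q) d) L

{-# OPTIONS --safe #-}
module Submission where

-- Write Δ k = v k + v (k + 1) mod 2.  Then Δ (m Q + p − 1) = 1, Δ (m Q + Q − 1) = 1 − Δ m, and
-- Δ vanishes elsewhere.  With N = Qⁿ, one has v (y + x N) = v x + v y for y < N, and a step of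
-- length N + 1 sends (x, y) to (x + 1, y + 1), so the colour is kept exactly when Δ x = Δ y, as
-- long as y + 1 < N.  When y wraps around from N − 1 to 0, the residue of x − y mod Q grows by 1.
-- While x − y ≢ 0 mod Q, a step on which Δ x ≠ Δ y comes after less than Q² steps, and close to a
-- wrap at a place that can be computed.  A long progression therefore has a stretch with
-- x ≡ y mod Q; this stretch has at most N terms, and continues beyond its two ends for at most
-- max (p − 1, 1) and max (q − 1, 1) terms.  Starting the stretch at y = 0 and x = (E + 1) N for an E
-- with suitable Δ E and Δ (E + 1) attains the bound.  For p = q = 1 residues mod Q do not suffice for
-- the upper bound, and the parity of x / 2 is used as well.

open import Defs
open import Data.Bool.Base using (Bool; true; false; not; _xor_)
open import Data.Bool.Properties
  using (not-injective; not-distribˡ-xor; not-distribʳ-xor; xor-assoc; xor-comm; xor-identityʳ;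
         xor-inverseˡ; xor-inverseʳ; xor-same)
open import Data.Empty using (⊥; ⊥-elim)
open import Data.Fin.Base using (Fin; zero; suc; toℕ; fromℕ<)
open import Data.Fin.Patterns using (0F; 1F)
open import Data.Fin.Properties using (toℕ-fromℕ<)
open import Data.List.Base using ([]; _∷_; _++_; length; lookup; replicate)
open import Data.List.Properties using (length-++; length-replicate)
open import Data.Nat.Base
open import Data.Nat.DivMod using (_/_; _%_; m≡m%n+[m/n]*n; m%n<n)
open import Data.Nat.Properties
open import Data.Nat.Tactic.RingSolver using (solve-∀)
open import Data.Product.Base using (_×_; _,_; ∃; ∃₂; proj₁; proj₂)
open import Data.Sum.Base using (_⊎_; inj₁; inj₂)
open import Relation.Binary.Definitions using (tri<; tri≈; tri>)
open import Relation.Binary.PropositionalEquality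
open import Relation.Nullary.Decidable using (yes; no)
open import Relation.Nullary.Negation using (¬_; contradiction)

-- Letters as Booleans, and identities of exclusive or.

bit : Fin 2 → Bool
bit 0F = false
bit 1F = true

bit-injective : ∀ {x y} → bit x ≡ bit y → x ≡ y
bit-injective {0F} {0F} _ = refl
bit-injective {1F} {1F} _ = refl
bit-injective {0F} {1F} ()
bit-injective {1F} {0F} ()

xor-cancelʳ : ∀ x y → (x xor y) xor y ≡ x
xor-cancelʳ x y = trans (xor-assoc x y y) (trans (cong (x xor_) (xor-same y)) (xor-identityʳ x))

xor-cancelˡ : ∀ x {y z} → x xor y ≡ z → x xor z ≡ y
xor-cancelˡ x {y} refl = trans (sym (xor-assoc x x y)) (cong (_xor y) (xor-same x))

xor-exchange : ∀ x y z t → x xor y ≡ z xor t → x xor z ≡ y xor t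
xor-exchange false y     false _     refl = sym (xor-same y)
xor-exchange false _     true  t     refl = sym (xor-inverseˡ t)
xor-exchange true  y     false _     refl = sym (xor-inverseʳ y)
xor-exchange true  false true  false _    = refl
xor-exchange true  true  true  true  _    = refl

-- Letters of a word by position, and blocks of a substituted word.

at : Word → ℕ → Fin 2
at []       _       = 0F
at (x ∷ xs) zero    = x
at (x ∷ xs) (suc i) = at xs i

at-lookup : ∀ xs (j : Fin (length xs)) → lookup xs j ≡ at xs (toℕ j)
at-lookup (x ∷ xs) zero    = refl
at-lookup (x ∷ xs) (suc j) = at-lookup xs j

at-++ˡ : ∀ xs {ys i} → i < length xs → at (xs ++ ys) i ≡ at xs i
at-++ˡ (x ∷ xs) {i = zero}  _       = refl
at-++ˡ (x ∷ xs) {i = suc i} (s≤s l) = at-++ˡ xs l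

at-++ʳ : ∀ xs {ys i} → at (xs ++ ys) (length xs + i) ≡ at ys i
at-++ʳ []       = refl
at-++ʳ (x ∷ xs) = at-++ʳ xs

at-replicate : ∀ {n x i} → i < n → at (replicate n x) i ≡ x
at-replicate {suc n} {i = zero}  _       = refl
at-replicate {suc n} {i = suc i} (s≤s l) = at-replicate l

length-block : ∀ m n (x y : Fin 2) → length (replicate m x ++ replicate n y) ≡ m + n
length-block m n x y = trans (length-++ (replicate m x))
  (cong₂ _+_ (length-replicate m) (length-replicate n))

length-θ : ∀ p q x → length (θ p q x) ≡ p + q
length-θ p q 0F = length-block p q 0F 1F
length-θ p q 1F = length-block p q 1F 0F

at-block-left : ∀ m n {x y i} → i < m → at (replicate m x ++ replicate n y) i ≡ x
at-block-left m n {x} {y} {i} i<m = trans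
  (at-++ˡ (replicate m x) (subst (i <_) (sym (length-replicate m)) i<m)) (at-replicate i<m)

at-block-right : ∀ m n {x y i} → i < n → at (replicate m x ++ replicate n y) (m + i) ≡ y
at-block-right m n {x} {y} {i} i<n = trans
  (cong (λ l → at (replicate m x ++ replicate n y) (l + i)) (sym (length-replicate m)))
  (trans (at-++ʳ (replicate m x)) (at-replicate i<n))

at-θ* : ∀ p q w {m r} → m < length w → r < p + q →
        at (θ* p q w) (r + m * (p + q)) ≡ at (θ p q (at w m)) r
at-θ* p q (x ∷ w) {zero} {r} _ r<Q = trans (cong (at (θ* p q (x ∷ w))) (+-identityʳ r))
  (at-++ˡ (θ p q x) (subst (r <_) (sym (length-θ p q x)) r<Q))
at-θ* p q (x ∷ w) {suc m} {r} (s≤s m<w) r<Q = trans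
  (cong (at (θ* p q (x ∷ w))) (trans (regroup r (p + q) (m * (p + q)))
    (cong (_+ (r + m * (p + q))) (sym (length-θ p q x)))))
  (trans (at-++ʳ (θ p q x)) (at-θ* p q w m<w r<Q))
  where
  regroup : ∀ r Q k → r + (Q + k) ≡ Q + (r + k)
  regroup = solve-∀

-- gain (p − 1) = max (p − 1, 1).
gain : ℕ → ℕ
gain zero    = 1
gain (suc n) = suc n

1≤gain : ∀ n → 1 ≤ gain n
1≤gain zero    = z<s
1≤gain (suc n) = z<s

n≤gain : ∀ n → n ≤ gain n
n≤gain zero    = z≤n
n≤gain (suc n) = ≤-refl

gain≤1+n : ∀ n → gain n ≤ suc n
gain≤1+n zero    = ≤-refl
gain≤1+n (suc n) = n≤1+n (suc n)

true≢false : true ≢ false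
true≢false ()

-- Block structure of the infinite word.

module GeneralisedThueMorse (p′ q′ : ℕ) where

  p q Q : ℕ
  p = suc p′
  q = suc q′
  Q = p + q

  v-at : ∀ n {i} → i < Q ^ n → v p q i ≡ at (θⁿ0 p q n) i
  v-at n {i} i<Qⁿ = begin
    v p q i                    ≡⟨ cong (v p q) (toℕ-fromℕ< i<len) ⟨
    v p q (toℕ (fromℕ< i<len)) ≡⟨ v-limit p q n (fromℕ< i<len) ⟨
    lookup (θⁿ0 p q n) _       ≡⟨ at-lookup (θⁿ0 p q n) _ ⟩
    at (θⁿ0 p q n) _           ≡⟨ cong (at (θⁿ0 p q n)) (toℕ-fromℕ< i<len) ⟩
    at (θⁿ0 p q n) i           ∎
    where
    open ≡-Reasoning
    i<len : i < length (θⁿ0 p q n)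
    i<len = subst (i <_) (sym (length-θⁿ0 p q n)) i<Qⁿ

  -- The limit is a fixed point of the substitution. Since `m < Q ^ m`, letter `m` can be read in
  -- `θⁿ0 p q m`, and its image is then a block of `θⁿ0 p q (suc m)`.
  v-θ : ∀ m {r} → r < Q → v p q (r + m * Q) ≡ at (θ p q (v p q m)) r
  v-θ m {r} r<Q = begin
    v p q (r + m * Q)                  ≡⟨ v-at (suc m) bound ⟩
    at (θⁿ0 p q (suc m)) (r + m * Q)   ≡⟨ at-θ* p q (θⁿ0 p q m) (n<length-θⁿ0 p q m) r<Q ⟩
    at (θ p q (at (θⁿ0 p q m) m)) r    ≡⟨ cong (λ x → at (θ p q x) r) (v-at m m<Qᵐ) ⟨
    at (θ p q (v p q m)) r             ∎
    where
    open ≡-Reasoning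
    m<Qᵐ : m < Q ^ m
    m<Qᵐ = subst (m <_) (length-θⁿ0 p q m) (n<length-θⁿ0 p q m)
    bound : r + m * Q < Q ^ suc m
    bound = ≤-trans (+-monoˡ-≤ (m * Q) r<Q)
      (≤-trans (*-monoˡ-≤ Q m<Qᵐ) (≤-reflexive (*-comm (Q ^ m) Q)))

  opaque
    -- Opaque, so that `w i` never unfolds to a lookup in an iterated word; the rest of the proof
    -- sees only the five facts of this block.
    w : ℕ → Bool
    w i = bit (v p q i)

    w-left : ∀ m {r} → r < p → w (r + m * Q) ≡ w m
    w-left m {r} r<p rewrite v-θ m (<-≤-trans r<p (m≤m+n p q)) with v p q m
    ... | 0F = cong bit (at-block-left p q r<p)
    ... | 1F = cong bit (at-block-left p q r<p)

    w-right : ∀ m {s} → s < q → w (p + s + m * Q) ≡ not (w m)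
    w-right m {s} s<q rewrite v-θ m (+-monoʳ-< p s<q) with v p q m
    ... | 0F = cong bit (at-block-right p q s<q)
    ... | 1F = cong bit (at-block-right p q s<q)

    w-0 : w 0 ≡ false
    w-0 = refl

    w⇒v : ∀ {i j} → w i ≡ w j → v p q i ≡ v p q j
    w⇒v = bit-injective

    v⇒w : ∀ {i j} → v p q i ≡ v p q j → w i ≡ w j
    v⇒w = cong bit

  data Digit : ℕ → Set where
    left  : ∀ {r} → r < p → Digit r
    right : ∀ {s} → s < q → Digit (p + s)

  digit : ∀ {r} → r < Q → Digit r
  digit {r} r<Q with r <? p
  ... | yes r<p = left r<p
  ... | no  r≮p = subst Digit p+s≡r
          (right (+-cancelˡ-< p (r ∸ p) q (subst (_< Q) (sym p+s≡r) r<Q)))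
    where
    p+s≡r : p + (r ∸ p) ≡ r
    p+s≡r = m+[n∸m]≡n (≮⇒≥ r≮p)

  -- Induction on `n`, splitting off the last base-`Q` digit of `y`: a digit below `p` leaves both
  -- sides as they are, any other digit negates both.
  w-concat : ∀ n x {y} → y < Q ^ n → w (y + x * Q ^ n) ≡ w x xor w y
  w-concat zero x {zero} _ =
    trans (cong w (*-identityʳ x))
      (trans (sym (xor-identityʳ (w x))) (cong (w x xor_) (sym w-0)))
  w-concat zero x {suc y} (s≤s ())
  w-concat (suc n) x {y} y<Qⁿ⁺¹ =
    subst (λ z → w (z + x * Q ^ suc n) ≡ w x xor w z) (sym y≡) (by-digit (digit (m%n<n y Q)))
    where
    y′ = y / Q
    y≡ : y ≡ y % Q + y′ * Q
    y≡ = m≡m%n+[m/n]*n y Q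
    y′<Qⁿ : y′ < Q ^ n
    y′<Qⁿ = *-cancelʳ-< Q y′ (Q ^ n) (≤-<-trans
      (≤-trans (m≤n+m (y′ * Q) (y % Q)) (≤-reflexive (sym y≡)))
      (subst (y <_) (*-comm Q (Q ^ n)) y<Qⁿ⁺¹))
    regroup : ∀ r k x Q N → r + k * Q + x * (Q * N) ≡ r + (k + x * N) * Q
    regroup = solve-∀
    by-digit : ∀ {r} → Digit r → w (r + y′ * Q + x * Q ^ suc n) ≡ w x xor w (r + y′ * Q)
    by-digit {r} (left r<p) = begin
      w (r + y′ * Q + x * Q ^ suc n)     ≡⟨ cong w (regroup r y′ x Q (Q ^ n)) ⟩
      w (r + (y′ + x * Q ^ n) * Q)       ≡⟨ w-left (y′ + x * Q ^ n) r<p ⟩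
      w (y′ + x * Q ^ n)                 ≡⟨ w-concat n x y′<Qⁿ ⟩
      w x xor w y′                       ≡⟨ cong (w x xor_) (w-left y′ r<p) ⟨
      w x xor w (r + y′ * Q)             ∎
      where open ≡-Reasoning
    by-digit {r} (right s<q) = begin
      w (r + y′ * Q + x * Q ^ suc n)     ≡⟨ cong w (regroup r y′ x Q (Q ^ n)) ⟩
      w (r + (y′ + x * Q ^ n) * Q)       ≡⟨ w-right (y′ + x * Q ^ n) s<q ⟩
      not (w (y′ + x * Q ^ n))           ≡⟨ cong not (w-concat n x y′<Qⁿ) ⟩
      not (w x xor w y′)                 ≡⟨ not-distribʳ-xor (w x) (w y′) ⟩
      w x xor not (w y′)                 ≡⟨ cong (w x xor_) (w-right y′ s<q) ⟨
      w x xor w (r + y′ * Q)             ∎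
      where open ≡-Reasoning

  -- Differences of consecutive letters.

  Δ : ℕ → Bool
  Δ k = w k xor w (suc k)

  Δ-middle : ∀ m → Δ (p′ + m * Q) ≡ true
  Δ-middle m = trans (cong₂ _xor_ (w-left m ≤-refl)
    (trans (cong (λ z → w (suc z + m * Q)) (sym (+-identityʳ p′))) (w-right m z<s))) (xor-inverseʳ (w m))

  -- Block `m` ends with the complement of `w m`, and the next block begins with `w (suc m)`.
  Δ-last : ∀ m → Δ (p + q′ + m * Q) ≡ not (Δ m)
  Δ-last m = trans (cong₂ _xor_ (w-right m ≤-refl)
    (trans (cong (λ z → w (suc z)) (shift p′ q′ (m * Q))) (w-left (suc m) z<s)))
    (sym (not-distribˡ-xor (w m) (w (suc m))))
    where
    shift : ∀ a b k → suc a + b + k ≡ a + suc b + k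
    shift = solve-∀

  Δ-left : ∀ m {r} → r < p′ → Δ (r + m * Q) ≡ false
  Δ-left m r<p′ = trans (cong₂ _xor_ (w-left m (m<n⇒m<1+n r<p′)) (w-left m (s≤s r<p′))) (xor-same (w m))

  Δ-right : ∀ m {s} → s < q′ → Δ (p + s + m * Q) ≡ false
  Δ-right m {s} s<q′ = trans (cong₂ _xor_ (w-right m (m<n⇒m<1+n s<q′))
    (trans (cong (λ z → w (suc z + m * Q)) (sym (+-suc p′ s))) (w-right m (s≤s s<q′)))) (xor-same (not (w m)))

  infix 4 _~_
  -- Congruence modulo `Q`; multiples are added on both sides to avoid subtraction.
  _~_ : ℕ → ℕ → Set
  x ~ y = ∃₂ λ u v → x + u * Q ≡ y + v * Q

  ~-reflexive : ∀ {x y} → x ≡ y → x ~ y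
  ~-reflexive x≡y = 0 , 0 , cong (_+ 0) x≡y

  ~-sym : ∀ {x y} → x ~ y → y ~ x
  ~-sym (u , v , eq) = v , u , sym eq

  ~-+ : ∀ {x y z t} → x ~ y → z ~ t → x + z ~ y + t
  ~-+ {x} {y} {z} {t} (u , v , eq) (u′ , v′ , eq′) =
    u + u′ , v + v′ , trans (regroup x z u u′ Q) (trans (cong₂ _+_ eq eq′) (sym (regroup y t v v′ Q)))
    where
    regroup : ∀ x z u u′ Q → x + z + (u + u′) * Q ≡ (x + u * Q) + (z + u′ * Q)
    regroup = solve-∀

  ~-cancelʳ : ∀ {x y} h → x + h ~ y + h → x ~ y
  ~-cancelʳ {x} {y} h (u , v , eq) = u , v , +-cancelʳ-≡ h (x + u * Q) (y + v * Q)
    (trans (regroup x u h Q) (trans eq (sym (regroup y v h Q))))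
    where
    regroup : ∀ x u h Q → x + u * Q + h ≡ x + h + u * Q
    regroup = solve-∀

  ~-trans : ∀ {x y z} → x ~ y → y ~ z → x ~ z
  ~-trans {x} {y} {z} x~y y~z =
    ~-cancelʳ y (~-trans′ (~-+ x~y y~z))
    where
    ~-trans′ : x + y ~ y + z → x + y ~ z + y
    ~-trans′ = subst (x + y ~_) (+-comm y z)

  ~-multiple : ∀ x m → x + m * Q ~ x
  ~-multiple x m = 0 , m , +-identityʳ (x + m * Q)

  ~-reduce : ∀ {x s} → x ~ s → s < Q → ∃ λ m → x ≡ s + m * Q
  ~-reduce {x} {s} (u , v , eq) s<Q with u ≤? v
  ... | yes u≤v = v ∸ u , +-cancelʳ-≡ (u * Q) x (s + (v ∸ u) * Q) (begin
    x + u * Q                   ≡⟨ eq ⟩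
    s + v * Q                   ≡⟨ cong (λ z → s + z * Q) (m∸n+n≡m u≤v) ⟨
    s + (v ∸ u + u) * Q         ≡⟨ regroup s (v ∸ u) u Q ⟩
    s + (v ∸ u) * Q + u * Q     ∎)
    where
    open ≡-Reasoning
    regroup : ∀ s k u Q → s + (k + u) * Q ≡ s + k * Q + u * Q
    regroup = solve-∀
  ... | no u≰v = contradiction eq (>⇒≢ (begin-strict
    s + v * Q    <⟨ +-monoˡ-< (v * Q) s<Q ⟩
    suc v * Q    ≤⟨ *-monoˡ-≤ Q (≰⇒> u≰v) ⟩
    u * Q        ≤⟨ m≤n+m (u * Q) x ⟩
    x + u * Q    ∎))
    where open ≤-Reasoning

  ~-unique : ∀ {s t} → s ~ t → s < Q → t < Q → s ≡ t
  ~-unique {s} {t} s~t s<Q t<Q with ~-reduce s~t t<Q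
  ... | zero  , eq = trans eq (+-identityʳ t)
  ... | suc m , eq = contradiction s<Q (≤⇒≯ (begin
    Q                 ≤⟨ m≤m+n Q (m * Q) ⟩
    suc m * Q         ≤⟨ m≤n+m (suc m * Q) t ⟩
    t + suc m * Q     ≡⟨ eq ⟨
    s                 ∎))
    where open ≤-Reasoning

  ~-% : ∀ x → x ~ x % Q
  ~-% x = subst (_~ x % Q) (sym (m≡m%n+[m/n]*n x Q)) (~-multiple (x % Q) (x / Q))

  Q~0 : Q ~ 0
  Q~0 = 0 , 1 , refl

  carry : ∀ m → suc (p + q′ + m * Q) ~ 0
  carry m = subst (λ k → k + m * Q ~ 0) (+-suc p q′) (~-multiple 0 (suc m))

  p<Q : p < Q
  p<Q = m<m+n p z<s

  p′<Q : p′ < Q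
  p′<Q = <-trans (n<1+n p′) p<Q

  -- Differences by residue.

  Δ-p : ∀ {x} → x ~ p′ → Δ x ≡ true
  Δ-p x~p′ with m , refl ← ~-reduce x~p′ p′<Q = Δ-middle m

  -- The bound excludes the residue Q - 1, where `Δ` depends on the block; apart from p - 1, all
  -- other residues lie inside a run of equal letters.
  Δ-false : ∀ {x s} → x ~ s → suc s < Q → s ≢ p′ → Δ x ≡ false
  Δ-false {x} {s} x~s 1+s<Q s≢p′ with m , refl ← ~-reduce x~s (<-trans (n<1+n s) 1+s<Q) | <-cmp s p′
  ... | tri< s<p′ _ _ = Δ-left m s<p′
  ... | tri≈ _ s≡p′ _ = contradiction s≡p′ s≢p′
  ... | tri> _ _ p≤s  =
    subst (λ z → Δ (z + m * Q) ≡ false) p+t≡s (Δ-right m t<q′)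
    where
    p+t≡s : p + (s ∸ p) ≡ s
    p+t≡s = m+[n∸m]≡n p≤s
    t<q′ : s ∸ p < q′
    t<q′ = +-cancelˡ-< p (s ∸ p) q′ (subst₂ _<_ (sym p+t≡s) refl
      (s≤s⁻¹ (subst (suc (suc s) ≤_) (+-suc p q′) 1+s<Q)))

  Δ-true : ∀ {x} → Δ x ≡ true → x ~ p′ ⊎ x ~ p + q′
  Δ-true {x} eq with x % Q ≟ p′ | suc (x % Q) <? Q
  ... | yes x%Q≡p′ | _ = inj₁ (~-trans (~-% x) (~-reflexive x%Q≡p′))
  ... | no  x%Q≢p′ | yes lt =
    contradiction (trans (sym eq) (Δ-false (~-% x) lt x%Q≢p′)) true≢false
  ... | no  _      | no ≮ = inj₂ (~-trans (~-% x) (~-reflexive (suc-injective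
    (trans (≤-antisym (m%n<n x Q) (≮⇒≥ ≮)) (+-suc p q′)))))

  Δ-last-false : ∀ {m} → m ~ p′ → Δ (p + q′ + m * Q) ≡ false
  Δ-last-false {m} m~p′ = trans (Δ-last m) (cong not (Δ-p m~p′))

  -- If x = y + r with r ≢ 0, then y ≡ p − 1 forces r ≡ q, the pair with y ≡ Q − 1 forces p ≠ q, and
  -- x ≡ p − 1 then requires Δ y = 1 at a residue where Δ vanishes.
  no-shift : ∀ r → ¬ r ~ 0 →
    (∀ s → suc s < Q → ∃₂ λ x y → y ~ s × x ~ s + r × Δ x ≡ Δ y) →
    (∃₂ λ x m → m ~ p′ × x ~ p + q′ + r × Δ x ≡ Δ (p + q′ + m * Q)) → ⊥
  no-shift r r≁0 cover (x₂ , m , m~p′ , x₂~ , eq₂) = by-order (<-cmp p′ q′)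
    where
    r~q : r ~ q
    r~q with x , y , y~ , x~ , eq ← cover p′ p<Q with Δ-true (trans eq (Δ-p y~))
    ... | inj₁ x~p′ = contradiction
      (~-cancelʳ p′ (~-trans (~-reflexive (+-comm r p′)) (~-trans (~-sym x~) x~p′))) r≁0
    ... | inj₂ x~l  = ~-cancelʳ p′ (~-trans (~-reflexive (+-comm r p′))
      (~-trans (~-sym x~) (~-trans x~l (~-reflexive (shift p′ q′)))))
      where
      shift : ∀ a b → suc a + b ≡ suc b + a
      shift = solve-∀

    p′≢q′ : p′ ≢ q′
    p′≢q′ p′≡q′ = contradiction
      (trans (sym (Δ-p (~-trans x₂~ (~-trans (~-+ (~-reflexive refl) r~q) last+q))))
        (trans eq₂ (Δ-last-false m~p′))) true≢false
      where
      last+q : p + q′ + q ~ p′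
      last+q = 0 , 1 , trans (+-identityʳ (p + q′ + q))
        (trans (shift p′ q′) (cong (_+ 1 * Q) (sym p′≡q′)))
        where
        shift : ∀ a b → suc a + b + suc b ≡ b + 1 * (suc a + suc b)
        shift = solve-∀

    clash : ∀ s → suc s < Q → s ≢ p′ → s + q ~ p′ → ⊥
    clash s 1+s<Q s≢p′ s+q~p′ with x , y , y~ , x~ , eq ← cover s 1+s<Q = contradiction
      (trans (sym (Δ-p (~-trans x~ (~-trans (~-+ (~-reflexive refl) r~q) s+q~p′))))
        (trans eq (Δ-false y~ 1+s<Q s≢p′))) true≢false

    by-order : _ → ⊥
    by-order (tri≈ _ p′≡q′ _) = p′≢q′ p′≡q′
    -- In both remaining cases `s` solves s + q ≡ p - 1 modulo Q: it is p - 1 + p if p < q, and p -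
    -- 1 - q if q < p.
    by-order (tri< p′<q′ _ _) = clash (p′ + p)
      (+-monoʳ-< p (s≤s p′<q′))
      (m+1+n≢m p′)
      (0 , 1 , shift p′ q)
      where
      shift : ∀ a b → a + suc a + b + 0 * (suc a + b) ≡ a + 1 * (suc a + b)
      shift = solve-∀
    by-order (tri> _ _ q′<p′) = clash (p′ ∸ q)
      (<-trans (s≤s p′∸q<p′) p<Q)
      (<⇒≢ p′∸q<p′)
      (~-reflexive (m∸n+n≡m q′<p′))
      where
      p′∸q<p′ : p′ ∸ q < p′
      p′∸q<p′ = ∸-monoʳ-< z<s q′<p′

  -- A monochromatic progression with M terms before its first wrap, which leads to y = 0 and x = c,
  -- and K terms from there on: its length exceeds the claimed maximum by one.  In `before` the
  -- pair (x, y) is (c − 1 − k, N − k).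
  record Steps (N M K c : ℕ) : Set where
    field
      T       : ℕ
      N≡      : N ≡ suc T * Q * Q
      1≤M     : 1 ≤ M
      M≤N     : M ≤ N
      M<c     : M < c
      total   : M + K ≡ suc (N + (gain p′ + gain q′))
      -- `k = 1` is the last term before the wrap, whose step is not an ordinary one.
      before  : ∀ k x y → 2 ≤ k → k ≤ M → y + k ≡ N → suc x + k ≡ c → Δ x ≡ Δ y
      after   : ∀ j → suc j < K → suc j < N → Δ (c + j) ≡ Δ j
      later   : ∀ j → suc (N + j) < K → suc j < N → Δ (c + suc N + j) ≡ Δ j
      -- The second wrap leads from (c + N - 1, N - 1) to (c + N + 1, 0): a wrap adds 2 to the first
      -- coordinate.
      wrap    : N < K → w (c + pred N) xor w (pred N) ≡ w (c + suc N)

  -- Progressions never aligned modulo `Q`.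

  module _ {N M K c} (S : Steps N M K c) where
    open Steps S

    N≡Q+ : N ≡ Q + (p′ + q + T * Q) * Q
    N≡Q+ = trans N≡ (expand (p′ + q) T)
      where
      expand : ∀ R T → suc T * suc R * suc R ≡ suc R + (R + T * suc R) * suc R
      expand = solve-∀

    Q*Q≤N : Q * Q ≤ N
    Q*Q≤N = begin
      Q * Q           ≤⟨ *-monoˡ-≤ Q (m≤m+n Q (T * Q)) ⟩
      suc T * Q * Q   ≡⟨ N≡ ⟨
      N               ∎
      where open ≤-Reasoning

    Q+Q≤N : Q + Q ≤ N
    Q+Q≤N = ≤-trans (≤-reflexive (cong (Q +_) (sym (+-identityʳ Q))))
      (≤-trans (*-monoˡ-≤ Q (+-mono-≤ (s≤s (z≤n {p′})) (s≤s (z≤n {q′})))) Q*Q≤N)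

    Q<N : Q < N
    Q<N = <-≤-trans (m<m+n Q z<s) Q+Q≤N

    N~0 : N ~ 0
    N~0 = subst (_~ 0) (sym N≡) (~-multiple 0 (suc T * Q))

    gains<K : gain p′ + gain q′ < K
    gains<K = +-cancelˡ-≤ M _ _ (begin
      M + suc (gain p′ + gain q′)   ≤⟨ +-monoˡ-≤ _ M≤N ⟩
      N + suc (gain p′ + gain q′)   ≡⟨ +-suc N _ ⟩
      suc (N + (gain p′ + gain q′)) ≡⟨ total ⟨
      M + K                         ∎)
      where open ≤-Reasoning

    N+gain<K : M ≤ gain q′ → N + gain p′ < K
    N+gain<K M≤ = +-cancelˡ-≤ (gain q′) _ _ (begin
      gain q′ + suc (N + gain p′)    ≡⟨ regroup (gain q′) N (gain p′) ⟩
      suc (N + (gain p′ + gain q′))  ≡⟨ total ⟨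
      M + K                          ≤⟨ +-monoˡ-≤ K M≤ ⟩
      gain q′ + K                    ∎)
      where
      open ≤-Reasoning
      regroup : ∀ b N a → b + suc (N + a) ≡ suc (N + (a + b))
      regroup = solve-∀

    -- As `N ~ 0`, one has y ≡ -k and x = c - 1 - k ≡ r - k: the shift x - y is `r` before the wrap,
    -- one less than after it.
    shifted-before : ∀ k y r → 2 ≤ k → k ≤ M → y + k ≡ N → c ~ suc r →
              ∃ λ x → x ~ y + r × Δ x ≡ Δ y
    shifted-before k y r 2≤k k≤M y+k≡N c~ = x , x~ , before k x y 2≤k k≤M y+k≡N x≡
      where
      x = c ∸ suc k
      x≡ : suc x + k ≡ c
      x≡ = trans (sym (+-suc x k)) (m∸n+n≡m (≤-<-trans k≤M M<c))
      regroup : ∀ y k r → suc r + (y + k) ≡ y + r + suc k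
      regroup = solve-∀
      x~ : x ~ y + r
      x~ = ~-cancelʳ (suc k) (~-trans (~-reflexive (trans (+-suc x k) x≡))
        (~-trans c~ (~-trans (~-reflexive (sym (+-identityʳ (suc r))))
          (~-trans (~-+ (~-reflexive {suc r} refl) (~-sym (subst (_~ 0) (sym y+k≡N) N~0)))
            (~-reflexive (regroup y k r))))))

    -- More than `p * Q` terms would provide all that `no-shift` needs: the first Q - 1 steps meet
    -- every residue of y other than Q - 1, and the step at y = pQ - 1 is the special pair, with
    -- block number p - 1.
    after-bound : ∀ r → ¬ r ~ 0 → c ~ r → K ≤ p * Q
    after-bound r r≁0 c~r with K ≤? p * Q
    ... | yes K≤ = K≤
    ... | no  K≰ = ⊥-elim (no-shift r r≁0
      (λ s 1+s<Q → c + s , s , ~-reflexive refl , c+s~ s ,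
        after s (<-trans (<-≤-trans 1+s<Q (m≤m+n Q (p′ * Q))) (≰⇒> K≰)) (<-trans 1+s<Q Q<N))
      (_ , p′ , ~-reflexive refl , ~-trans (c+s~ (p + q′ + p′ * Q))
          (~-+ (~-multiple (p + q′) p′) (~-reflexive refl)) ,
        after (p + q′ + p′ * Q) (subst (_< K) (sym last≡) (≰⇒> K≰))
          (subst (_< N) (sym last≡) (<-≤-trans (*-monoˡ-< Q p<Q) Q*Q≤N))))
      where
      c+s~ : ∀ s → c + s ~ s + r
      c+s~ s = ~-trans (~-+ c~r (~-reflexive {s} refl)) (~-reflexive (+-comm r s))
      last≡ : suc (p + q′ + p′ * Q) ≡ p * Q
      last≡ = cong (_+ p′ * Q) (sym (+-suc p q′))

    -- Mirror image of `after-bound`. The last block below `N` provides the residues; the special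
    -- pair has y = N - qQ - 1, whose block number is ≡ p - 1 because Q² divides `N`.
    before-bound : ∀ r → ¬ r ~ 0 → c ~ suc r → M ≤ q * Q
    before-bound r r≁0 c~ with M ≤? q * Q
    ... | yes M≤ = M≤
    ... | no  M≰ = ⊥-elim (no-shift r r≁0 cover special)
      where
      y : ℕ → ℕ
      y s = s + (p′ + q + T * Q) * Q
      y~ : ∀ s → y s ~ s
      y~ s = ~-multiple s (p′ + q + T * Q)
      y+k≡N : ∀ {s} → s ≤ Q → y s + (Q ∸ s) ≡ N
      y+k≡N {s} s≤Q = begin
        y s + (Q ∸ s)                       ≡⟨ swap s _ (Q ∸ s) ⟩
        s + (Q ∸ s) + (p′ + q + T * Q) * Q  ≡⟨ cong (_+ (p′ + q + T * Q) * Q) (m+[n∸m]≡n s≤Q) ⟩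
        Q + (p′ + q + T * Q) * Q            ≡⟨ N≡Q+ ⟨
        N                                   ∎
        where
        open ≡-Reasoning
        swap : ∀ s m k → s + m + k ≡ s + k + m
        swap = solve-∀
      cover : ∀ s → suc s < Q → ∃₂ λ x y → y ~ s × x ~ s + r × Δ x ≡ Δ y
      cover s 1+s<Q =
        let x , x~ , eq = shifted-before (Q ∸ s) (y s) r
                      (m+n≤o⇒m≤o∸n 2 1+s<Q)
                      (≤-trans (m∸n≤m Q s) (≤-trans (m≤m+n Q (q′ * Q)) (<⇒≤ (≰⇒> M≰))))
                      (y+k≡N (<⇒≤ (<-trans (n<1+n s) 1+s<Q))) c~
        in x , y s , y~ s , ~-trans x~ (~-+ (y~ s) (~-reflexive refl)) , eq
      regroup : ∀ l a b T Q → l + (a + T * Q) * Q + suc (b * Q) ≡ suc l + (a + b + T * Q) * Q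
      regroup = solve-∀
      y₂+k≡N : p + q′ + (p′ + T * Q) * Q + suc (q * Q) ≡ N
      y₂+k≡N = trans (regroup (p + q′) p′ q T Q)
        (trans (cong (_+ (p′ + q + T * Q) * Q) (sym (+-suc p q′))) (sym N≡Q+))
      special : ∃₂ λ x m → m ~ p′ × x ~ p + q′ + r × Δ x ≡ Δ (p + q′ + m * Q)
      special =
        let x , x~ , eq = shifted-before (suc (q * Q)) (p + q′ + (p′ + T * Q) * Q) r
                      (s≤s z<s) (≰⇒> M≰) y₂+k≡N c~
        in x , p′ + T * Q , ~-multiple p′ T ,
        ~-trans x~ (~-+ (~-multiple (p + q′) (p′ + T * Q)) (~-reflexive refl)) , eq

    -- The shifts on both sides of the wrap are nonzero, so the two bounds add up to at most Q²,
    -- hence at most `N`, terms.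
    misaligned : ∀ r → suc (suc r) < Q → c ~ suc (suc r) → ⊥
    misaligned r lt c~ = <-irrefl total (begin-strict
      M + K                          ≤⟨ +-mono-≤ (before-bound (suc r) (≁0 (<-trans (n<1+n _) lt)) c~)
                                                 (after-bound (suc (suc r)) (≁0 lt) c~) ⟩
      q * Q + p * Q                  ≡⟨ +-comm (q * Q) (p * Q) ⟩
      p * Q + q * Q                  ≡⟨ *-distribʳ-+ Q p q ⟨
      Q * Q                          ≤⟨ Q*Q≤N ⟩
      N                              ≤⟨ m≤m+n N _ ⟩
      N + (gain p′ + gain q′)        <⟨ n<1+n _ ⟩
      suc (N + (gain p′ + gain q′))  ∎)
      where
      open ≤-Reasoning
      ≁0 : ∀ {s} → suc s < Q → ¬ suc s ~ 0
      ≁0 lt s~0 with () ← ~-unique s~0 lt z<s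

  -- Aligned progressions for Q > 2.

  -- After an aligned stretch the shift is 1. If p = 1, the step at j = 0 fails, since `Δ 0` is 1
  -- and residue 1 is neither p - 1 nor Q - 1. If p > 1, the step at j = p - 2 fails, since x + j ≡
  -- p - 1.
  ends-after-wrap : 1 ≤ p′ + q′ → ∀ {x} → x ~ 1 → (∀ j → j < gain p′ → Δ (x + j) ≡ Δ j) → ⊥
  ends-after-wrap 1≤ {x} x~1 agree with p′ ≟ 0
  ... | yes p′≡0 = contradiction (trans (sym (Δ-p (~-reflexive (sym p′≡0))))
      (trans (sym (agree 0 (1≤gain p′))) (Δ-false (~-trans (~-reflexive (+-identityʳ x)) x~1)
        (s≤s (≤-trans (s≤s 1≤) (≤-reflexive (sym (+-suc p′ q′)))))
        (λ 1≡p′ → contradiction (trans 1≡p′ p′≡0) λ ())))) true≢false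
  ... | no p′≢0 = contradiction
      (trans (sym (Δ-p (~-trans (~-+ x~1 (~-reflexive {pred p′} refl)) (~-reflexive 1+j≡p′))))
        (trans (agree (pred p′) (≤-trans (≤-reflexive 1+j≡p′) (n≤gain p′)))
          (Δ-false (~-reflexive refl) (≤-<-trans (≤-reflexive 1+j≡p′) p′<Q)
            (<⇒≢ (≤-reflexive 1+j≡p′))))) true≢false
      where
      1+j≡p′ : suc (pred p′) ≡ p′
      1+j≡p′ = suc-pred p′ {{≢-nonZero p′≢0}}

  module _ {N M K c} (S : Steps N M K c) (1≤ : 1 ≤ p′ + q′) where
    open Steps S

    j<gain⇒1+j<N : ∀ {j} → j < gain p′ → suc j < N
    j<gain⇒1+j<N j< = ≤-<-trans (≤-trans j< (≤-trans (gain≤1+n p′) (<⇒≤ p<Q))) (Q<N S)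

    -- Here the aligned stretch precedes the wrap. It has at most `N` terms, which leaves enough
    -- terms after it for `ends-after-wrap`.
    aligned-before : c ~ 1 → ⊥
    aligned-before c~1 = ends-after-wrap 1≤ c~1 λ j j< →
      after j (≤-<-trans (≤-trans j< (m≤m+n (gain p′) (gain q′))) (gains<K S)) (j<gain⇒1+j<N j<)

    -- Before the wrap x ≡ y - 1. The step that fails is at `k = q` if q > 1, where y ≡ p and x ≡ p
    -- - 1, and at `k = 2` if q = 1, where y ≡ p - 1 and x ≡ p - 2.
    few-before : c ~ 0 → M ≤ gain q′
    few-before c~0 with M ≤? gain q′ | q′ ≟ 0
    ... | yes M≤ | _ = M≤
    ... | no  M≰ | no q′≢0 = ⊥-elim (clash (before q x y 2≤q q≤M y+q≡N x+q≡c))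
      where
      2≤q : 2 ≤ q
      2≤q = s≤s (n≢0⇒n>0 q′≢0)
      q≤M : q ≤ M
      q≤M = ≤-trans (s≤s (n≤gain q′)) (≰⇒> M≰)
      y = N ∸ q
      x = c ∸ suc q
      y+q≡N : y + q ≡ N
      y+q≡N = m∸n+n≡m (≤-trans q≤M M≤N)
      x+q≡c : suc x + q ≡ c
      x+q≡c = trans (sym (+-suc x q)) (m∸n+n≡m (≤-<-trans q≤M M<c))
      y~p : y ~ p
      y~p = ~-cancelʳ q (~-trans (~-reflexive y+q≡N) (~-trans (N~0 S) (~-sym Q~0)))
      x~p′ : x ~ p′
      x~p′ = ~-cancelʳ (suc q) (~-trans (~-reflexive (trans (+-suc x q) x+q≡c))
        (~-trans c~0 (~-trans (~-sym Q~0) (~-reflexive (sym (+-suc p′ q))))))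
      clash : Δ x ≡ Δ y → ⊥
      clash eq = contradiction (trans (sym (Δ-p x~p′)) (trans eq (Δ-false y~p
        (≤-trans (≤-reflexive (sym (cong suc (+-comm p 1)))) (+-monoʳ-< p 2≤q)) 1+n≢n))) true≢false
    ... | no  M≰ | yes q′≡0 = ⊥-elim (clash (before 2 x y ≤-refl 2≤M y+k≡N x+k≡c))
      where
      2≤M : 2 ≤ M
      2≤M = ≤-trans (s≤s (1≤gain q′)) (≰⇒> M≰)
      y = N ∸ 2
      x = c ∸ 3
      y+k≡N : y + 2 ≡ N
      y+k≡N = m∸n+n≡m (≤-trans 2≤M M≤N)
      x+k≡c : suc x + 2 ≡ c
      x+k≡c = trans (sym (+-suc x 2)) (m∸n+n≡m (≤-<-trans 2≤M M<c))
      Q≡ : Q ≡ p′ + 2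
      Q≡ = trans (cong (λ z → p + suc z) q′≡0) (sym (+-suc p′ 1))
      1+j≡p′ : suc (pred p′) ≡ p′
      1+j≡p′ = suc-pred p′ {{>-nonZero (subst (1 ≤_) (trans (cong (p′ +_) q′≡0) (+-identityʳ p′)) 1≤)}}
      y~p′ : y ~ p′
      y~p′ = ~-cancelʳ 2 (~-trans (~-reflexive y+k≡N) (~-trans (N~0 S) (~-trans (~-sym Q~0) (~-reflexive Q≡))))
      x~ : x ~ pred p′
      x~ = ~-cancelʳ 3 (~-trans (~-reflexive (trans (+-suc x 2) x+k≡c))
        (~-trans c~0 (~-trans (~-sym Q~0) (~-reflexive
          (trans Q≡ (trans (cong (_+ 2) (sym 1+j≡p′)) (sym (+-suc (pred p′) 2))))))))
      clash : Δ x ≡ Δ y → ⊥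
      clash eq = contradiction (trans (sym (Δ-p y~p′)) (trans (sym eq) (Δ-false x~
        (≤-<-trans (≤-reflexive 1+j≡p′) p′<Q) (<⇒≢ (≤-reflexive 1+j≡p′))))) true≢false

    -- Now the aligned stretch is the `N` terms after the wrap. With few terms before it, the
    -- progression must run more than `gain p′` terms past the second wrap, where x ≡ y + 1.
    aligned-after : c ~ 0 → ⊥
    aligned-after c~0 = ends-after-wrap 1≤
      (~-trans (~-+ c~0 (~-+ (~-reflexive {1} refl) (N~0 S))) (~-reflexive refl)) λ j j< →
      later j (≤-<-trans (≤-trans (≤-reflexive (sym (+-suc N j))) (+-monoʳ-≤ N j<))
        (N+gain<K S (few-before c~0))) (j<gain⇒1+j<N j<)

    no-steps-Q>2 : ⊥
    no-steps-Q>2 with c % Q in eq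
    ... | zero        = aligned-after (~-trans (~-% c) (~-reflexive eq))
    ... | suc zero    = aligned-before (~-trans (~-% c) (~-reflexive eq))
    ... | suc (suc r) = misaligned S r (subst (_< Q) eq (m%n<n c Q)) (~-trans (~-% c) (~-reflexive eq))

-- The case p = q = 1.

1-or-2 : ∀ {m} → 1 ≤ m → m ≤ 2 → m ≡ 1 ⊎ m ≡ 2
1-or-2 {1} _ _ = inj₁ refl
1-or-2 {2} _ _ = inj₂ refl
1-or-2 {suc (suc (suc m))} _ (s≤s (s≤s ()))

module ThueMorse where
  open GeneralisedThueMorse 0 0

  Δ-odd : ∀ {x} m → x ≡ 1 + m * 2 → Δ x ≡ not (Δ m)
  Δ-odd m x≡ = trans (cong Δ x≡) (Δ-last m)

  true⇒odd-false : ∀ {x} m → x ≡ 1 + m * 2 → Δ x ≡ true → Δ m ≡ false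
  true⇒odd-false m x≡ Δx = not-injective (trans (sym (Δ-odd m x≡)) Δx)

  false⇒odd-true : ∀ {x} m → x ≡ 1 + m * 2 → Δ x ≡ false → Δ m ≡ true
  false⇒odd-true m x≡ Δx = not-injective (trans (sym (Δ-odd m x≡)) Δx)

  Δ-even : ∀ m → Δ (m * 2) ≡ true
  Δ-even m = Δ-p (~-multiple 0 m)

  false⇒odd : ∀ {x} → Δ x ≡ false → ∃ λ m → x ≡ 1 + m * 2
  false⇒odd {x} Δx with x % 2 in eq | m%n<n x 2
  ... | zero        | _ = contradiction (trans (sym (Δ-p (~-trans (~-% x) (~-reflexive eq)))) Δx) true≢false
  ... | suc zero    | _ = ~-reduce (~-trans (~-% x) (~-reflexive eq)) ≤-refl
  ... | suc (suc _) | s≤s (s≤s ())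

  module _ {N M K c} (S : Steps N M K c) where
    open Steps S

    N≡4+ : N ≡ 4 + T * 4
    N≡4+ = trans N≡ (expand T)
      where
      expand : ∀ T → suc T * 2 * 2 ≡ 4 + T * 4
      expand = solve-∀

    4≤N : 4 ≤ N
    4≤N = ≤-trans (m≤m+n 4 (T * 4)) (≤-reflexive (sym N≡4+))

    total′ : M + K ≡ N + 3
    total′ = trans total (sym (+-suc N 2))

    -- The step at j = 1 fails: `c + 1` is even, so its difference is 1, while `Δ 1` is 0.
    even-start : c ~ 1 → ⊥
    even-start c~1 = contradiction
      (trans (sym (Δ-p (~-trans (~-+ c~1 (~-reflexive {1} refl)) Q~0)))
        (trans (after 1 (gains<K S) (<-≤-trans (s≤s (s≤s (s≤s z≤n))) 4≤N))
          (Δ-last-false {0} (~-reflexive refl)))) true≢false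

    -- The step at `k = 3` fails: x = c - 4 is even, while y = N - 3 = 4T + 1 has difference 0.
    M≤2 : c ~ 0 → M ≤ 2
    M≤2 c~0 with M ≤? 2
    ... | yes M≤2 = M≤2
    ... | no  M≰2 = contradiction
      (trans (sym (Δ-p x~0)) (trans (before 3 x y (s≤s (s≤s z≤n)) (≰⇒> M≰2) y+3≡N x+3≡c)
        (Δ-last-false {T * 2} (~-multiple 0 T)))) true≢false
      where
      x = c ∸ 4
      y = 1 + (T * 2) * 2
      y+3≡N : y + 3 ≡ N
      y+3≡N = trans (collect T) (sym N≡)
        where
        collect : ∀ T → 1 + (T * 2) * 2 + 3 ≡ suc T * 2 * 2
        collect = solve-∀
      x+3≡c : suc x + 3 ≡ c
      x+3≡c = trans (sym (+-suc x 3)) (m∸n+n≡m (≤-<-trans (≰⇒> M≰2) M<c))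
      x~0 : x ~ 0
      x~0 = ~-cancelʳ 4 (~-trans (~-reflexive (trans (+-suc x 3) x+3≡c)) (~-trans c~0 (2 , 0 , refl)))

    -- Already the first step outside the full block of N terms forces c / 2 to be odd.
    half-odd : ∀ h → c ≡ h * 2 → ∃ λ m → h ≡ 1 + m * 2
    half-odd h c≡ = by-M (1-or-2 1≤M (M≤2 (~-trans (~-reflexive c≡) (~-multiple 0 h))))
      where
      by-M : M ≡ 1 ⊎ M ≡ 2 → ∃ λ m → h ≡ 1 + m * 2
      -- `K` is now N + 2, so the first step after the second wrap is available. There `Δ 0` is 1,
      -- so h + N / 2 is odd, and N / 2 is even.
      by-M (inj₁ M≡1) = odd-shift (false⇒odd (true⇒odd-false (h + suc T * 2) position
        (trans (later 0 N+1<K (<-≤-trans (s≤s (s≤s z≤n)) 4≤N)) (Δ-p (~-reflexive refl)))))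
        where
        N+1<K : suc (N + 0) < K
        N+1<K = +-cancelˡ-≤ 1 _ _ (≤-reflexive (trans (regroup N)
          (trans (sym total′) (cong (_+ K) M≡1))))
          where
          regroup : ∀ N → 1 + suc (suc (N + 0)) ≡ N + 3
          regroup = solve-∀
        position : c + suc N + 0 ≡ 1 + (h + suc T * 2) * 2
        position = trans (cong₂ (λ c N → c + suc N + 0) c≡ N≡) (regroup h T)
          where
          regroup : ∀ h T → h * 2 + suc (suc T * 2 * 2) + 0 ≡ 1 + (h + suc T * 2) * 2
          regroup = solve-∀
        odd-shift : (∃ λ m → h + suc T * 2 ≡ 1 + m * 2) → ∃ λ m → h ≡ 1 + m * 2
        odd-shift (m , eq) = ~-reduce (suc T , m , eq) ≤-refl
      -- The step at `k = 2` has y even and x = c - 3 = 1 + 2m; hence `Δ m` is 0, `m` is odd, and so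
      -- is h = m + 2.
      by-M (inj₂ M≡2) = odd-x (~-reduce x~1 ≤-refl)
        where
        2≤M : 2 ≤ M
        2≤M = ≤-reflexive (sym M≡2)
        x = c ∸ 3
        y = N ∸ 2
        x+2≡c : suc x + 2 ≡ c
        x+2≡c = trans (sym (+-suc x 2)) (m∸n+n≡m (≤-<-trans 2≤M M<c))
        y+2≡N : y + 2 ≡ N
        y+2≡N = m∸n+n≡m (≤-trans 2≤M M≤N)
        x~1 : x ~ 1
        x~1 = ~-cancelʳ 3 (~-trans (~-reflexive (trans (+-suc x 2) (trans x+2≡c c≡)))
          (~-trans (~-multiple 0 h) (2 , 0 , refl)))
        y~0 : y ~ 0
        y~0 = ~-cancelʳ 2 (~-trans (~-reflexive y+2≡N) (~-trans (N~0 S) (1 , 0 , refl)))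
        odd-x : (∃ λ m → x ≡ 1 + m * 2) → ∃ λ m → h ≡ 1 + m * 2
        odd-x (m , x≡) = let m′ , m≡ = false⇒odd (true⇒odd-false m x≡
                               (trans (before 2 x y ≤-refl 2≤M y+2≡N x+2≡c) (Δ-p y~0)))
          in suc m′ , trans (*-cancelʳ-≡ h (2 + m) 2 (trans (sym c≡) (trans (sym x+2≡c)
               (trans (cong (λ z → suc z + 2) x≡) (regroup m))))) (cong (2 +_) m≡)
          where
          regroup : ∀ m → suc (1 + m * 2) + 2 ≡ (2 + m) * 2
          regroup = solve-∀

    N<K : c ~ 0 → N < K
    N<K c~0 = +-cancelˡ-≤ 2 _ _ (begin
      2 + suc N   ≡⟨ regroup N ⟩
      N + 3       ≡⟨ total′ ⟨
      M + K       ≤⟨ +-monoˡ-≤ K (M≤2 c~0) ⟩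
      2 + K       ∎)
      where
      open ≤-Reasoning
      regroup : ∀ N → 2 + suc N ≡ N + 3
      regroup = solve-∀

    -- For N ≥ 8 the steps at j = 1 and j = 5 contradict each other; N = 4 has no step at j = 5, and
    -- the second wrap takes its place.
    half-not-odd : ∀ h m → c ≡ h * 2 → h ≡ 1 + m * 2 → ⊥
    half-not-odd h m c≡ h≡ with T ≟ 0
    -- As `w 3` is 0, the wrap gives `w (c + 3) ≡ w (c + 5)`, hence `Δ (suc h)` is 0, although
    -- `suc h` is even.
    ... | yes T≡0 = contradiction (trans (sym (Δ-even (suc m))) (trans (cong Δ (cong suc (sym h≡)))
          (wrap-Δ (subst (λ N → w (c + pred N) xor w (pred N) ≡ w (c + suc N)) N≡4
            (wrap (N<K (~-trans (~-reflexive c≡) (~-multiple 0 h))))))))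
          true≢false
      where
      N≡4 : N ≡ 4
      N≡4 = trans N≡4+ (cong (λ T → 4 + T * 4) T≡0)
      odd₁ : ∀ h → h * 2 + 3 ≡ 1 + suc h * 2
      odd₁ = solve-∀
      odd₂ : ∀ h → h * 2 + 5 ≡ 1 + suc (suc h) * 2
      odd₂ = solve-∀
      w-odd : ∀ {x} k → x ≡ 1 + k * 2 → w x ≡ not (w k)
      w-odd k x≡ = trans (cong w x≡) (w-right k z<s)
      w-3 : w 3 ≡ false
      w-3 = trans (w-odd 1 refl) (cong not (trans (w-odd 0 refl) (cong not w-0)))
      wrap-Δ : w (c + 3) xor w 3 ≡ w (c + 5) → Δ (suc h) ≡ false
      wrap-Δ eq = trans (cong (_xor w (suc (suc h))) (not-injective
        (trans (sym (w-odd (suc h) (trans (cong (_+ 3) c≡) (odd₁ h))))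
          (trans (sym (trans (cong (w (c + 3) xor_) w-3) (xor-identityʳ (w (c + 3))))) (trans eq
            (w-odd (suc (suc h)) (trans (cong (_+ 5) c≡) (odd₂ h))))))))
        (xor-same (w (suc (suc h))))
    -- The step at j = 1 makes `Δ h` equal to 1, so `m` is odd; the step at j = 5 makes `Δ (suc m)`
    -- equal to 0, so `suc m` is odd as well.
    ... | no T≢0 = contradiction
          (trans (sym (Δ-even (suc k))) (trans (cong Δ (cong suc (sym m≡))) Δ-1+m)) true≢false
      where
      8≤N : 8 ≤ N
      8≤N = ≤-trans (+-monoʳ-≤ 4 (*-monoˡ-≤ 4 (n≢0⇒n>0 T≢0))) (≤-reflexive (sym N≡4+))
      6<N : 6 < N
      6<N = <-≤-trans (s≤s (m≤m+n 6 1)) 8≤N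
      after-N : ∀ j → suc j < N → Δ (c + j) ≡ Δ j
      after-N j lt = after j (<-trans lt (N<K (~-trans (~-reflexive c≡) (~-multiple 0 h)))) lt
      odd₁ : ∀ h → h * 2 + 1 ≡ 1 + h * 2
      odd₁ = solve-∀
      odd₂ : ∀ h → h * 2 + 5 ≡ 1 + (2 + h) * 2
      odd₂ = solve-∀
      Δ-h : Δ h ≡ true
      Δ-h = false⇒odd-true h (trans (cong (_+ 1) c≡) (odd₁ h))
        (trans (after-N 1 (≤-trans (s≤s (s≤s (s≤s z≤n))) 8≤N)) (trans (Δ-odd 0 refl) (cong not (Δ-even 0))))
      Δ-2+h : Δ (2 + h) ≡ true
      Δ-2+h = false⇒odd-true (2 + h) (trans (cong (_+ 5) c≡) (odd₂ h))
        (trans (after-N 5 6<N) (trans (Δ-odd 2 refl) (cong not (Δ-even 1))))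
      Δ-1+m : Δ (suc m) ≡ false
      Δ-1+m = true⇒odd-false (suc m) (cong (2 +_) h≡) Δ-2+h
      Δ-m : ∃ λ k → m ≡ 1 + k * 2
      Δ-m = false⇒odd (true⇒odd-false m h≡ Δ-h)
      k = proj₁ Δ-m
      m≡ : m ≡ 1 + k * 2
      m≡ = proj₂ Δ-m

    no-steps-Q≡2 : ⊥
    no-steps-Q≡2 with c % 2 in eq | m%n<n c 2
    ... | suc (suc _) | s≤s (s≤s ())
    ... | suc zero    | _ = even-start (~-trans (~-% c) (~-reflexive eq))
    ... | zero        | _ =
      let h , c≡ = ~-reduce {s = 0} (~-trans (~-% c) (~-reflexive eq)) z<s
          m , h≡ = half-odd h c≡
      in half-not-odd h m c≡ h≡

no-steps : ∀ p′ q′ {N M K c} → GeneralisedThueMorse.Steps p′ q′ N M K c → ⊥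
no-steps zero     zero     = ThueMorse.no-steps-Q≡2
no-steps zero     (suc q′) S = GeneralisedThueMorse.no-steps-Q>2 zero (suc q′) S z<s
no-steps (suc p′) q′       S = GeneralisedThueMorse.no-steps-Q>2 (suc p′) q′ S z<s

-- Differences near the ends of a longest progression.

isZero : ℕ → Bool
isZero zero    = true
isZero (suc n) = false

Δ-after : ∀ p′ q′ j → j < gain p′ → GeneralisedThueMorse.Δ p′ q′ j ≡ isZero p′
Δ-after zero q′ zero _ = Δ-p (~-reflexive refl)
  where open GeneralisedThueMorse zero q′
Δ-after zero q′ (suc j) (s≤s ())
Δ-after (suc p′) q′ j j<p =
  Δ-false (~-reflexive refl) (s≤s (<-≤-trans j<p (m≤m+n (suc p′) (suc q′)))) (<⇒≢ j<p)
  where open GeneralisedThueMorse (suc p′) q′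

-- The places start at residue p - 1 if q = 1, and run from p to at most Q - 2 if q > 1.
Δ-before : ∀ p′ q′ k R → GeneralisedThueMorse._~_ p′ q′ (R + suc (gain q′)) 0 → k < gain q′ →
           GeneralisedThueMorse.Δ p′ q′ (R + k) ≡ isZero q′
Δ-before p′ zero zero R R+2~0 _ = Δ-p (~-cancelʳ 2
  (~-trans (~-reflexive (cong (_+ 2) (+-identityʳ R))) (~-trans R+2~0 (~-trans (~-sym Q~0)
    (~-reflexive (sym (+-suc p′ 1)))))))
  where open GeneralisedThueMorse p′ zero
Δ-before p′ zero (suc k) R _ (s≤s ())
Δ-before p′ (suc q′) k R R+q~0 k<q = Δ-false {s = p + k}
  (~-+ (~-cancelʳ (suc (suc q′)) (~-trans R+q~0 (~-sym Q~0))) (~-reflexive {k} refl))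
  (s≤s (subst (_≤ p′ + suc (suc q′)) (trans (+-suc p′ (suc k)) (cong suc (+-suc p′ k)))
    (+-monoʳ-≤ p′ (s≤s k<q))))
  (>⇒≢ (s≤s (m≤m+n p′ k)))
  where open GeneralisedThueMorse p′ (suc q′)

-- Unless p = q = 1, `E` is the last place of a block `m`: then `suc E ~ 0` has the required
-- difference, and `Δ E` is the negation of `Δ m`. The choice m = 0 serves when p or q is 1, and m =
-- p - 1 otherwise.
centre : ∀ p′ q′ → ∃ λ E → GeneralisedThueMorse.Δ p′ q′ E ≡ isZero q′ ×
                           GeneralisedThueMorse.Δ p′ q′ (suc E) ≡ isZero p′
centre zero zero = 2 , ThueMorse.Δ-even 1 ,
  trans (ThueMorse.Δ-odd 1 refl) (cong not (trans (ThueMorse.Δ-odd 0 refl) (cong not (ThueMorse.Δ-even 0))))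
centre (suc p′) zero = p + 0 + 0 * Q ,
  trans (Δ-last 0) (cong not (Δ-false (~-reflexive refl) (s≤s z<s) λ ())) ,
  Δ-false (carry 0) (s≤s z<s) λ ()
  where open GeneralisedThueMorse (suc p′) zero
centre zero (suc q′) = p + suc q′ + 0 * Q , Δ-last-false {0} (~-reflexive refl) ,
  Δ-p (carry 0)
  where open GeneralisedThueMorse zero (suc q′)
centre (suc p′) (suc q′) = p + suc q′ + suc p′ * Q , Δ-last-false {suc p′} (~-reflexive refl) ,
  Δ-false (carry (suc p′)) (s≤s z<s) λ ()
  where open GeneralisedThueMorse (suc p′) (suc q′)

-- Coordinates in base `N`.

module Maximum (p′ q′ n : ℕ) where
  open GeneralisedThueMorse p′ q′

  N = Q ^ suc (suc n)

  block : ∀ x y → y < N → w (y + x * N) ≡ w x xor w y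
  block x y = w-concat (suc (suc n)) x

  T : ℕ
  T = pred (Q ^ n)

  N≡ : N ≡ suc T * Q * Q
  N≡ = trans (regroup Q (Q ^ n)) (cong (λ k → k * Q * Q) (sym (suc-pred (Q ^ n) {{m^n≢0 Q n}})))
    where
    regroup : ∀ Q k → Q * (Q * k) ≡ k * Q * Q
    regroup = solve-∀

  Q≤N : Q ≤ N
  Q≤N = ≤-trans (≤-trans (m≤m+n Q (T * Q)) (m≤m*n (suc T * Q) Q)) (≤-reflexive (sym N≡))

  instance
    N-nonZero : NonZero N
    N-nonZero = m^n≢0 Q (suc (suc n))

  1≤N : 1 ≤ N
  1≤N = >-nonZero⁻¹ N

  L : ℕ
  L = N + (gain p′ + gain q′)

  -- The upper bound.

  module TooLong (i : ℕ) (mono : ∀ k → k ≤ L → w (i + k * (N + 1)) ≡ w i) where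
    -- Term `t` has coordinates (a + t, b + t) until b + t reaches `N` at t = M; the carry then
    -- gives (a + M + 1, 0), whence `c`.
    a b M K c : ℕ
    a = i / N
    b = i % N
    M = N ∸ b
    K = suc L ∸ M
    c = suc (a + M)

    i≡ : i ≡ b + a * N
    i≡ = m≡m%n+[m/n]*n i N

    b+M≡N : b + M ≡ N
    b+M≡N = m+[n∸m]≡n (<⇒≤ (m%n<n i N))

    M+K≡ : M + K ≡ suc L
    M+K≡ = m+[n∸m]≡n (≤-trans (m∸n≤m N b) (≤-trans (m≤m+n N _) (n≤1+n L)))

    term : ∀ t x y → t < M + K → y < N → i + t * (N + 1) ≡ y + x * N → w x xor w y ≡ w i
    term t x y t< y<N eq = trans (sym (block x y y<N))
      (trans (cong w (sym eq)) (mono t (s≤s⁻¹ (subst (suc t ≤_) M+K≡ t<))))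

    step : ∀ t x y → suc t < M + K → suc y < N → i + t * (N + 1) ≡ y + x * N → Δ x ≡ Δ y
    step t x y t< y<N eq = xor-exchange (w x) (w y) (w (suc x)) (w (suc y))
      (trans (term t x y (<-trans (n<1+n t) t<) (<-trans (n<1+n y) y<N) eq)
        (sym (term (suc t) (suc x) (suc y) t< y<N next)))
      where
      regroup₁ : ∀ i t N → i + suc t * (N + 1) ≡ suc N + (i + t * (N + 1))
      regroup₁ = solve-∀
      regroup₂ : ∀ x y N → suc N + (y + x * N) ≡ suc y + suc x * N
      regroup₂ = solve-∀
      next : i + suc t * (N + 1) ≡ suc y + suc x * N
      next = trans (regroup₁ i t N) (trans (cong (suc N +_) eq) (regroup₂ x y N))

    position : ∀ j → i + (M + j) * (N + 1) ≡ j + (c + j) * N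
    position j = trans (cong (_+ (M + j) * (N + 1)) i≡) (trans (regroup₁ a b M j N)
      (trans (cong (_+ (j + (a + M + j) * N)) b+M≡N) (regroup₂ a M j N)))
      where
      regroup₁ : ∀ a b M j N → b + a * N + (M + j) * (N + 1) ≡ b + M + (j + (a + M + j) * N)
      regroup₁ = solve-∀
      regroup₂ : ∀ a M j N → N + (j + (a + M + j) * N) ≡ j + (suc (a + M) + j) * N
      regroup₂ = solve-∀

    position-later : ∀ j → i + (M + (N + j)) * (N + 1) ≡ j + (c + suc N + j) * N
    position-later j = trans (position (N + j)) (regroup c N j)
      where
      regroup : ∀ c N j → N + j + (c + (N + j)) * N ≡ j + (c + suc N + j) * N
      regroup = solve-∀

    M+suc< : ∀ {j} → suc j < K → suc (M + j) < M + K
    M+suc< {j} lt = subst (_< M + K) (+-suc M j) (+-monoʳ-< M lt)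

    steps : Steps N M K c
    steps = record
      { T      = T
      ; N≡     = N≡
      ; 1≤M    = m<n⇒0<n∸m (m%n<n i N)
      ; M≤N    = m∸n≤m N b
      ; M<c    = s≤s (m≤n+m M a)
      ; total  = M+K≡
      ; before = before
      ; after  = λ j j< j<N → step (M + j) (c + j) j (M+suc< j<) j<N (position j)
      ; later  = λ j j< j<N → step (M + (N + j)) (c + suc N + j) j (M+suc< j<) j<N (position-later j)
      ; wrap   = wrap
      }
      where
      before : ∀ k x y → 2 ≤ k → k ≤ M → y + k ≡ N → suc x + k ≡ c → Δ x ≡ Δ y
      before k x y 2≤k k≤M y+k≡N x+k≡c = step t x y
        (<-≤-trans (subst (suc t <_) t+k≡M (1+m<m+k t)) (m≤m+n M K))
        (subst (suc y <_) y+k≡N (1+m<m+k y)) (trans (cong (_+ t * (N + 1)) i≡)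
          (trans (regroup a b t N) (sym (cong₂ (λ x y → y + x * N) x≡ y≡))))
        where
        t = M ∸ k
        t+k≡M : t + k ≡ M
        t+k≡M = m∸n+n≡m k≤M
        1+m<m+k : ∀ m → suc m < m + k
        1+m<m+k m = ≤-trans (≤-reflexive (+-comm 2 m)) (+-monoʳ-≤ m 2≤k)
        x≡ : x ≡ a + t
        x≡ = +-cancelʳ-≡ k x (a + t) (suc-injective (trans x+k≡c
          (cong suc (trans (cong (a +_) (sym t+k≡M)) (sym (+-assoc a t k))))))
        y≡ : y ≡ b + t
        y≡ = +-cancelʳ-≡ k y (b + t) (trans y+k≡N (trans (sym b+M≡N)
          (trans (cong (b +_) (sym t+k≡M)) (sym (+-assoc b t k)))))
        regroup : ∀ a b t N → b + a * N + t * (N + 1) ≡ b + t + (a + t) * N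
        regroup = solve-∀
      wrap : N < K → w (c + pred N) xor w (pred N) ≡ w (c + suc N)
      wrap N<K = trans
        (term (M + pred N) (c + pred N) (pred N) (+-monoʳ-< M (≤-<-trans pred[n]≤n N<K))
          (≤-reflexive (suc-pred N)) (position (pred N)))
        (trans (sym (term (M + (N + 0)) (c + suc N + 0) 0
          (+-monoʳ-< M (≤-<-trans (≤-reflexive (+-identityʳ N)) N<K)) 1≤N (position-later 0)))
          (trans (cong₂ _xor_ (cong w (+-identityʳ (c + suc N))) w-0) (xor-identityʳ _)))

    too-long : ⊥
    too-long = no-steps p′ q′ steps

  -- A progression attaining the bound.

  module Witness (E : ℕ) (ΔE : Δ E ≡ isZero q′) (Δ1+E : Δ (suc E) ≡ isZero p′) where
    -- The start has y = N - g and x = E N + y - 1, so that after `g` terms the wrap leads to y = 0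
    -- and x = (E + 1) N.
    g h R i : ℕ
    g = gain q′
    h = gain p′
    R = N ∸ suc g
    i = suc R + (E * N + R) * N

    1+g≤Q : suc g ≤ Q
    1+g≤Q = s≤s (≤-trans (gain≤1+n q′) (m≤n+m q p′))

    R+1+g≡N : R + suc g ≡ N
    R+1+g≡N = m∸n+n≡m (≤-trans 1+g≤Q Q≤N)

    R+1+g~0 : R + suc g ~ 0
    R+1+g~0 = ~-trans (~-reflexive (trans R+1+g≡N N≡)) (~-multiple 0 (suc T * Q))

    -- Here x = E N + y - 1, so the colour is `w E` plus `Δ (R + k)`; this difference equals `Δ E`,
    -- which turns `w E` into `w (suc E)`.
    first : ∀ k → k < g → w (i + k * (N + 1)) ≡ w (suc E)
    first k k<g = begin
      w (i + k * (N + 1))                           ≡⟨ cong w (regroup R E k N) ⟩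
      w (suc (R + k) + (R + k + E * N) * N)         ≡⟨ block _ _ 1+R+k<N ⟩
      w (R + k + E * N) xor w (suc (R + k))         ≡⟨ cong (_xor w (suc (R + k)))
                                                        (block E (R + k) (<-trans (n<1+n _) 1+R+k<N)) ⟩
      (w E xor w (R + k)) xor w (suc (R + k))       ≡⟨ xor-assoc (w E) _ _ ⟩
      w E xor Δ (R + k)                             ≡⟨ xor-cancelˡ (w E)
                                                        (trans ΔE (sym (Δ-before p′ q′ k R R+1+g~0 k<g))) ⟩
      w (suc E)                                     ∎
      where
      open ≡-Reasoning
      regroup : ∀ R E k N → suc R + (E * N + R) * N + k * (N + 1) ≡ suc (R + k) + (R + k + E * N) * N
      regroup = solve-∀
      1+R+k<N : suc (R + k) < N
      1+R+k<N = subst₂ _<_ (+-suc R k) R+1+g≡N (+-monoʳ-< R (s≤s k<g))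

    position : ∀ j → i + (g + j) * (N + 1) ≡ j + (j + suc E * N) * N
    position j = trans (regroup₁ R E g j N)
      (trans (cong (_+ (j + (R + g + (j + E * N)) * N)) R+1+g≡N)
        (trans (regroup₂ R E g j N) (cong (λ z → j + (j + (z + E * N)) * N) R+1+g≡N)))
      where
      regroup₁ : ∀ R E g j N → suc R + (E * N + R) * N + (g + j) * (N + 1) ≡
                 R + suc g + (j + (R + g + (j + E * N)) * N)
      regroup₁ = solve-∀
      regroup₂ : ∀ R E g j N → N + (j + (R + g + (j + E * N)) * N) ≡ j + (j + (R + suc g + E * N)) * N
      regroup₂ = solve-∀

    middle : ∀ j → j < N → w (i + (g + j) * (N + 1)) ≡ w (suc E)
    middle j j<N = begin
      w (i + (g + j) * (N + 1))        ≡⟨ cong w (position j) ⟩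
      w (j + (j + suc E * N) * N)      ≡⟨ block _ j j<N ⟩
      w (j + suc E * N) xor w j        ≡⟨ cong (_xor w j) (block (suc E) j j<N) ⟩
      (w (suc E) xor w j) xor w j      ≡⟨ xor-cancelʳ (w (suc E)) (w j) ⟩
      w (suc E)                        ∎
      where open ≡-Reasoning

    -- Here x = (E + 2) N + j + 1, so the colour is `w (suc (suc E))` plus `Δ j`, and `Δ j` equals
    -- `Δ (suc E)`.
    last : ∀ j → j < h → w (i + (g + (N + j)) * (N + 1)) ≡ w (suc E)
    last j j<h = begin
      w (i + (g + (N + j)) * (N + 1))          ≡⟨ cong w (trans (position (N + j)) (regroup E j N)) ⟩
      w (j + (suc j + suc (suc E) * N) * N)    ≡⟨ block _ j (<-trans (n<1+n j) 1+j<N) ⟩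
      w (suc j + suc (suc E) * N) xor w j      ≡⟨ cong (_xor w j) (block (suc (suc E)) (suc j) 1+j<N) ⟩
      (w (suc (suc E)) xor w (suc j)) xor w j  ≡⟨ xor-assoc (w (suc (suc E))) _ _ ⟩
      w (suc (suc E)) xor (w (suc j) xor w j)  ≡⟨ cong (w (suc (suc E)) xor_) (xor-comm (w (suc j)) (w j)) ⟩
      w (suc (suc E)) xor Δ j                  ≡⟨ xor-cancelˡ (w (suc (suc E)))
                                                   (trans (xor-comm _ (w (suc E)))
                                                     (trans Δ1+E (sym (Δ-after p′ q′ j j<h)))) ⟩
      w (suc E)                                ∎
      where
      open ≡-Reasoning
      regroup : ∀ E j N → N + j + (N + j + suc E * N) * N ≡ j + (suc j + suc (suc E) * N) * N
      regroup = solve-∀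
      1+j<N : suc j < N
      1+j<N = <-≤-trans (≤-<-trans (≤-trans j<h (gain≤1+n p′)) p<Q) Q≤N

    constant : ∀ k → k < L → w (i + k * (N + 1)) ≡ w (suc E)
    constant k k<L with k <? g
    ... | yes k<g = first k k<g
    ... | no  k≮g with k ∸ g <? N
    ...   | yes lt = subst (λ k → w (i + k * (N + 1)) ≡ w (suc E))
            (m+[n∸m]≡n (≮⇒≥ k≮g)) (middle (k ∸ g) lt)
    ...   | no  ≮N = subst (λ k → w (i + k * (N + 1)) ≡ w (suc E)) k≡
            (last (k ∸ g ∸ N) (+-cancelˡ-< g _ _ (+-cancelˡ-< N _ _
              (subst₂ _<_ (trans (sym k≡) (regroup g N _)) (cong (N +_) (+-comm h g)) k<L))))
      where
      k≡ : g + (N + (k ∸ g ∸ N)) ≡ k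
      k≡ = trans (cong (g +_) (m+[n∸m]≡n (≮⇒≥ ≮N))) (m+[n∸m]≡n (≮⇒≥ k≮g))
      regroup : ∀ g N j → g + (N + j) ≡ N + (g + j)
      regroup = solve-∀

    progression : HasMonochromaticAP (v p q) (N + 1) L
    progression = ≤-trans 1≤N (m≤m+n N _) , i , λ k k<L → w⇒v (trans (constant k k<L)
      (sym (trans (cong w (sym (+-identityʳ i))) (constant 0 (≤-trans 1≤N (m≤m+n N _))))))

  upper : ∀ l → HasMonochromaticAP (v p q) (N + 1) l → l ≤ L
  upper l (_ , i , mono) with l ≤? L
  ... | yes l≤L = l≤L
  ... | no  l≰L = ⊥-elim (TooLong.too-long i λ k k≤L → v⇒w (mono k (≤-<-trans k≤L (≰⇒> l≰L))))

  maximum : A p q (N + 1) L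
  maximum = let E , ΔE , Δ1+E = centre p′ q′ in Witness.progression E ΔE Δ1+E , upper

  -- `k` counts how many of p and q exceed 1: `gain` falls short of such an exponent by one, and
  -- equals an exponent 1.
  maximum-∸ : ∀ k → gain p′ + gain q′ + k ≡ Q → A p q (N + 1) (N + Q ∸ k)
  maximum-∸ k eq = subst (A p q (N + 1)) (begin
    L                                   ≡⟨ m+n∸n≡m L k ⟨
    L + k ∸ k                           ≡⟨ cong (_∸ k) (+-assoc N (gain p′ + gain q′) k) ⟩
    N + (gain p′ + gain q′ + k) ∸ k     ≡⟨ cong (λ m → N + m ∸ k) eq ⟩
    N + Q ∸ k                           ∎) maximum
    where open ≡-Reasoning

-- The three cases of the value.

gains-both>1 : ∀ p′ q′ → suc p′ > 1 × suc q′ > 1 → gain p′ + gain q′ + 2 ≡ suc p′ + suc q′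
gains-both>1 zero    _        (s≤s () , _)
gains-both>1 (suc a) zero     (_ , s≤s ())
gains-both>1 (suc a) (suc b)  _ = regroup a b
  where
  regroup : ∀ a b → suc a + suc b + 2 ≡ suc (suc a) + suc (suc b)
  regroup = solve-∀

gains-one>1 : ∀ p′ q′ → (suc q′ > suc p′ × suc p′ ≡ 1) ⊎ (suc p′ > suc q′ × suc q′ ≡ 1) →
              gain p′ + gain q′ + 1 ≡ suc p′ + suc q′
gains-one>1 zero zero (inj₁ (s≤s () , _))
gains-one>1 zero zero (inj₂ (s≤s () , _))
gains-one>1 zero    (suc b) _ = cong suc (+-comm (suc b) 1)
gains-one>1 (suc a) zero    _ = cong suc (trans (+-assoc a 1 1) (+-suc a 1))
gains-one>1 (suc a) (suc b) (inj₁ (_ , ()))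
gains-one>1 (suc a) (suc b) (inj₂ (_ , ()))

gains-none>1 : ∀ p′ q′ → suc p′ ≡ 1 × suc q′ ≡ 1 → gain p′ + gain q′ + 0 ≡ suc p′ + suc q′
gains-none>1 zero zero _ = refl

proposition27 : ∀ (n p q : ℕ) .{{_ : NonZero p}} .{{_ : NonZero q}} → n > 1 →
    let Q = p + q in
    (p > 1 × q > 1 → A p q (Q ^ n + 1) (Q ^ n + Q ∸ 2))
    × ((q > p × p ≡ 1) ⊎ (p > q × q ≡ 1) → A p q (Q ^ n + 1) (Q ^ n + Q ∸ 1))
    × (p ≡ 1 × q ≡ 1 → A p q (Q ^ n + 1) (Q ^ n + Q))
proposition27 (suc (suc n)) (suc p′) (suc q′) _ =
    (λ h → maximum-∸ 2 (gains-both>1 p′ q′ h))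
  , (λ h → maximum-∸ 1 (gains-one>1 p′ q′ h))
  , (λ h → maximum-∸ 0 (gains-none>1 p′ q′ h))
  where open Maximum p′ q′ n
proposition27 (suc zero) (suc _) (suc _) (s≤s ())
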